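{- Let $a=\{a_1,\dots,a_m\}\subset\mathbb{P}\setminus\{1\}$ be a set of multiplicatively independent integers. For an integer $k$, let $G(a,k)$ be the graph with vertex set $\{1,2,\dots,k\}$ in which distinct vertices $i,j$ are adjacent iff $i\equiv a_r j \pmod{k+1}$ for some $r$. Let $G=G(a,k_1)+G(a,k_2)+\cdots+G(a,k_s)$, where $k_1+1,\dots,k_s+1$ are sufficiently large primes. Then the number of $n$-element independent sets of $G$ depends only on $n$, $m$, and $\sum_i k_i$: there is a function $f(n,m,K)$ such that for every such $a$ and every $n$, whenever $k_1+1,\dots,k_s+1$ are primes that are sufficiently large (with a bound depending on $a$ and $n$), the number of $n$-element independent sets of $G$ equals $f(n,m,\sum_i k_i)$.
   Context: $\mathbb{P}$ is the set of positive integers. Integers $a_1,\dots,a_m$ are multiplicatively independent if $a_1^{i_1}\cdots a_m^{i_m}=1$ with integers $i_j$ implies all $i_j=0$. $G_1+G_2+\cdots+G_s$ denotes the disjoint union of graphs. An $n$-element independent set is a set of $n$ vertices, no two adjacent. -}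

module Defs where

open import Data.Nat using (ℕ; zero; suc; _+_; _*_; _^_; _%_)
open import Data.Integer using (ℤ; +_; -[1+_])
open import Data.Fin using (Fin; toℕ; splitAt)
import Data.Fin as Fin
open import Data.Fin.Subset using (Subset; _∈_; ∣_∣)
open import Data.Vec using (Vec; lookup)
open import Data.List using (List; []; _∷_; length)
open import Data.Nat.ListAction using (sum)
open import Data.List.Relation.Unary.Unique.Propositional using (Unique)
import Data.List.Membership.Propositional as LM
open import Data.Sum using (_⊎_; inj₁; inj₂)
open import Data.Product using (Σ; ∃; _×_)
open import Data.Empty using (⊥)
open import Relation.Nullary using (¬_)
open import Relation.Binary.PropositionalEquality using (_≡_; _≢_)
open import Function.Bundles using (_⇔_)

prodFin : (m : ℕ) → (Fin m → ℕ) → ℕ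
prodFin zero    f = 1
prodFin (suc m) f = f Fin.zero * prodFin m (λ i → f (Fin.suc i))

pos : ℤ → ℕ
pos (+ n)     = n
pos -[1+ n ]  = 0

neg : ℤ → ℕ
neg (+ n)     = 0
neg -[1+ n ]  = suc n

-- a_1^{i_1} ⋯ a_m^{i_m} = 1 (in ℚ) written without denominators:
-- ∏ a_j^{i_j⁺} = ∏ a_j^{i_j⁻}; independence: this forces all i_j = 0.
MultIndependent : {m : ℕ} → Vec ℕ m → Set
MultIndependent {m} a =
  (e : Fin m → ℤ) →
  prodFin m (λ j → lookup a j ^ pos (e j)) ≡ prodFin m (λ j → lookup a j ^ neg (e j)) →
  (j : Fin m) → e j ≡ + 0

record Graph (N : ℕ) : Set₁ where
  field
    Adj : Fin N → Fin N → Set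
open Graph public

-- G(a,k): vertices 1..k (vertex i : Fin k stands for the integer toℕ i + 1);
-- distinct i, j adjacent iff i ≡ a_r j (mod k+1) or j ≡ a_r i (mod k+1) for some r
Gak : {m : ℕ} → Vec ℕ m → (k : ℕ) → Graph k
Adj (Gak {m} a k) i j =
  i ≢ j ×
  ∃ λ (r : Fin m) →
    ((suc (toℕ i)) % suc k ≡ (lookup a r * suc (toℕ j)) % suc k)
    ⊎ ((suc (toℕ j)) % suc k ≡ (lookup a r * suc (toℕ i)) % suc k)

emptyGraph : Graph 0
Adj emptyGraph () _

_⊕_ : {m n : ℕ} → Graph m → Graph n → Graph (m + n)
Adj (_⊕_ {m} G H) u v with splitAt m u | splitAt m v
... | inj₁ i | inj₁ j = Adj G i j
... | inj₂ i | inj₂ j = Adj H i j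
... | inj₁ _ | inj₂ _ = ⊥
... | inj₂ _ | inj₁ _ = ⊥

GSum : {m : ℕ} → Vec ℕ m → (ks : List ℕ) → Graph (sum ks)
GSum a []       = emptyGraph
GSum a (k ∷ ks) = Gak a k ⊕ GSum a ks

Independent : {N : ℕ} → Graph N → Subset N → Set
Independent G S = ∀ u v → u ∈ S → v ∈ S → ¬ Adj G u v

NumIndepSets≡ : {N : ℕ} → Graph N → (n c : ℕ) → Set
NumIndepSets≡ {N} G n c =
  Σ (List (Subset N)) λ L →
    Unique L × ((S : Subset N) → (S LM.∈ L) ⇔ (Independent G S × ∣ S ∣ ≡ n)) × length L ≡ c

{-# OPTIONS --safe #-}
-- Shifts by ℤ^m act on the vertices of G(a,k), an exponent vector e acting as multiplication
-- by ∏ a_r^{e_r} modulo the prime k + 1, and u, v are equal or adjacent iff v is the image of u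
-- under 0 or some ±e_r.  So n! times the number of n-element independent sets counts the tuples
-- w ∈ V^n with w_i ≠ g w_j for i ≠ j and these g.  Systems of constraints w_i ≠ g w_j are counted
-- by deletion and contraction: the tuples violating one constraint with i ≠ j correspond, through
-- w_i := g w_j, to the tuples in one variable fewer satisfying the transported remaining
-- constraints.  A constraint w_i ≠ g w_i is void or unsatisfiable according to whether g ≠ 0,
-- provided g acts without fixed points; by multiplicative independence this holds once k + 1
-- exceeds the monomials involved.  The recursion bottoms out at |V|^c, so it sees only n, m, |V|,
-- and it meets only finitely many g.
module Submission where

open import Defs
import Data.Bool as Bool
open import Data.Bool using (true; false)
open import Data.Bool.Properties using (¬-not)
open import Data.Fin using (Fin; zero; suc; fromℕ<; join; punchIn; punchOut; splitAt; toℕ)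
import Data.Fin.Properties as Fin
open import Data.Fin.Subset using (Subset; _∈_; ∣_∣; inside; outside)
import Data.Fin.Subset as Subset
open import Data.Fin.Subset.Properties using (_∈?_; ∉⊥; ∣⊥∣≡0)
open import Data.Integer using (_⊖_)
import Data.Integer as ℤ
import Data.Integer.Properties as ℤ
open import Data.List
  using (List; []; _∷_; _++_; allFin; cartesianProduct; cartesianProductWith; filter; length; map)
import Data.List.Membership.Propositional as LM
open import Data.List.Membership.Propositional.Properties
open import Data.List.Properties using (length-tabulate; map-tabulate)
open import Data.List.Relation.Unary.All as All using (All; []; _∷_)
import Data.List.Relation.Unary.All.Properties as All
open import Data.List.Relation.Unary.AllPairs using ([]; _∷_)
open import Data.List.Relation.Unary.Any using (here; there)
open import Data.List.Relation.Unary.Unique.Propositional using (Unique)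
import Data.List.Relation.Unary.Unique.Propositional.Properties as Unique
open import Data.Nat
open import Data.Nat.Coprimality using (prime⇒coprime; coprime-Bézout)
open import Data.Nat.DivMod
open import Data.Nat.GCD using (module Bézout)
open import Data.Nat.ListAction using (sum)
open import Data.Nat.Primality using (Prime)
open import Data.Nat.Properties
open import Data.Nat.Tactic.RingSolver using (solve-∀)
open import Data.Product using (Σ; ∃; _×_; _,_; proj₁; proj₂; swap)
open import Data.Sum as Sum using (_⊎_; inj₁; inj₂)
open import Data.Sum.Properties using (inj₁-injective; inj₂-injective)
open import Data.Vec as Vec using (Vec; []; _∷_; _[_]≔_; here; there; insertAt; lookup; replicate; zipWith)
open import Data.Vec.Properties
  using ( ∷-injective; ≡-dec; []=⇒lookup; lookup⇒[]=; []≔-lookup; []≔-idempotent; []≔-updates; []≔-minimal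
        ; insertAt-lookup; insertAt-punchIn; lookup∘tabulate; lookup∘update; lookup∘update′
        ; lookup-zipWith; zipWith-comm )
import Data.Vec.Relation.Binary.Pointwise.Extensional as Pointwise
import Data.Vec.Relation.Unary.All as VecAll
open import Data.Vec.Relation.Unary.All using ([]; _∷_) renaming (All to AllV)
import Data.Vec.Relation.Unary.All.Properties as VecAll
open import Function using (_∘_; id)
open import Function.Bundles using (_⇔_; mk⇔; Equivalence)
open import Relation.Binary.PropositionalEquality
open import Relation.Nullary
open import Relation.Nullary.Decidable using (_×-dec_; _→-dec_; _⊎-dec_; ¬?; map′)
open import Relation.Unary using (Decidable)

open Equivalence using (to; from)

private
  variable
    A B C : Set
    P Q : Set
    N N′ c l m n : ℕ

-- Indicators and finite sums.

ind : Dec P → ℕ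
ind (yes _) = 1
ind (no _)  = 0

ind-yes : (P? : Dec P) → P → ind P? ≡ 1
ind-yes (yes _) _ = refl
ind-yes (no ¬p) p = contradiction p ¬p

ind-no : (P? : Dec P) → ¬ P → ind P? ≡ 0
ind-no (no _)  _  = refl
ind-no (yes p) ¬p = contradiction p ¬p

ind-cong : (P? : Dec P) (Q? : Dec Q) → P ⇔ Q → ind P? ≡ ind Q?
ind-cong (yes p) Q? e = sym (ind-yes Q? (to e p))
ind-cong (no ¬p) Q? e = sym (ind-no Q? (¬p ∘ from e))

ind-× : (P? : Dec P) (Q? : Dec Q) → ind (P? ×-dec Q?) ≡ ind P? * ind Q?
ind-× (yes _) (yes _) = refl
ind-× (yes _) (no _)  = refl
ind-× (no _)  _       = refl

ind-split : (P? : Dec P) → ind P? + ind (¬? P?) ≡ 1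
ind-split (yes _) = refl
ind-split (no _)  = refl

∑ : List A → (A → ℕ) → ℕ
∑ xs f = sum (map f xs)

∑-cong : (xs : List A) {f g : A → ℕ} → (∀ x → f x ≡ g x) → ∑ xs f ≡ ∑ xs g
∑-cong []       e = refl
∑-cong (x ∷ xs) e = cong₂ _+_ (e x) (∑-cong xs e)

∑-zero : (xs : List A) {f : A → ℕ} → (∀ x → f x ≡ 0) → ∑ xs f ≡ 0
∑-zero []       e = refl
∑-zero (x ∷ xs) e = cong₂ _+_ (e x) (∑-zero xs e)

∑-+ : (xs : List A) (f g : A → ℕ) → ∑ xs (λ x → f x + g x) ≡ ∑ xs f + ∑ xs g
∑-+ []       f g = refl
∑-+ (x ∷ xs) f g rewrite ∑-+ xs f g = interchange (f x) (g x) (∑ xs f) (∑ xs g)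
  where
  interchange : ∀ a b c d → a + b + (c + d) ≡ a + c + (b + d)
  interchange = solve-∀

*-∑ : (c : ℕ) (xs : List A) (f : A → ℕ) → ∑ xs (λ x → c * f x) ≡ c * ∑ xs f
*-∑ c []       f = sym (*-zeroʳ c)
*-∑ c (x ∷ xs) f rewrite *-∑ c xs f = sym (*-distribˡ-+ c (f x) (∑ xs f))

∑-const : (xs : List A) (c : ℕ) → ∑ xs (λ _ → c) ≡ length xs * c
∑-const []       c = refl
∑-const (x ∷ xs) c = cong (c +_) (∑-const xs c)

∑-swap : (xs : List A) (ys : List B) (f : A → B → ℕ) →
  ∑ xs (λ x → ∑ ys (f x)) ≡ ∑ ys (λ y → ∑ xs (λ x → f x y))
∑-swap []       ys f = sym (∑-zero ys (λ _ → refl))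
∑-swap (x ∷ xs) ys f = begin
  ∑ ys (f x) + ∑ xs (λ x → ∑ ys (f x))             ≡⟨ cong (∑ ys (f x) +_) (∑-swap xs ys f) ⟩
  ∑ ys (f x) + ∑ ys (λ y → ∑ xs (λ x → f x y))     ≡⟨ ∑-+ ys (f x) _ ⟨
  ∑ ys (λ y → f x y + ∑ xs (λ x → f x y))          ∎
  where open ≡-Reasoning

∑-++ : (xs ys : List A) (f : A → ℕ) → ∑ (xs ++ ys) f ≡ ∑ xs f + ∑ ys f
∑-++ []       ys f = refl
∑-++ (x ∷ xs) ys f rewrite ∑-++ xs ys f = sym (+-assoc (f x) _ _)

∑-map : (h : A → B) (xs : List A) (f : B → ℕ) → ∑ (map h xs) f ≡ ∑ xs (f ∘ h)
∑-map h []       f = refl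
∑-map h (x ∷ xs) f = cong (f (h x) +_) (∑-map h xs f)

∑-cartesianProductWith : (h : A → B → C) (xs : List A) (ys : List B) (f : C → ℕ) →
  ∑ (cartesianProductWith h xs ys) f ≡ ∑ xs (λ x → ∑ ys (λ y → f (h x y)))
∑-cartesianProductWith h []       ys f = refl
∑-cartesianProductWith h (x ∷ xs) ys f = begin
  ∑ (map (h x) ys ++ cartesianProductWith h xs ys) f
    ≡⟨ ∑-++ (map (h x) ys) _ f ⟩
  ∑ (map (h x) ys) f + ∑ (cartesianProductWith h xs ys) f
    ≡⟨ cong₂ _+_ (∑-map (h x) ys f) (∑-cartesianProductWith h xs ys f) ⟩
  ∑ ys (f ∘ h x) + ∑ xs (λ x → ∑ ys (λ y → f (h x y))) ∎
  where open ≡-Reasoning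

length-filter : {P : A → Set} (P? : Decidable P) (xs : List A) →
  length (filter P? xs) ≡ ∑ xs (λ x → ind (P? x))
length-filter P? []       = refl
length-filter P? (x ∷ xs) with P? x
... | yes _ = cong suc (length-filter P? xs)
... | no _  = length-filter P? xs

-- Since the list has no repetitions, the sole witness `y` contributes exactly once. This collapses
-- a sum over subsets to the one that a tuple enumerates, and a sum over a coordinate to the value
-- forced on it.
∑-select : {P : A → Set} (P? : Decidable P) (f : A → ℕ) {xs : List A} {y : A} →
  Unique xs → y LM.∈ xs → P y → (∀ {x} → P x → x ≡ y) →
  ∑ xs (λ x → ind (P? x) * f x) ≡ f y
∑-select {A = A} {P} P? f {y ∷ xs} (y∉ ∷ _) (here refl) py only
  rewrite ind-yes (P? y) py = trans (cong₂ _+_ (+-identityʳ (f y)) (rest xs y∉)) (+-identityʳ (f y))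
  where
  rest : ∀ xs → All (y ≢_) xs → ∑ xs (λ x → ind (P? x) * f x) ≡ 0
  rest []       []       = refl
  rest (x ∷ xs) (y≢x ∷ y∉) rewrite ind-no (P? x) (λ px → y≢x (sym (only px))) = rest xs y∉
∑-select P? f {x ∷ xs} {y} (x∉ ∷ u) (there y∈) py only
  rewrite ind-no (P? x) (λ px → All.lookup x∉ y∈ (only px)) = ∑-select P? f u y∈ py only

-- Exhaustive lists of tuples and subsets.

vecs : List A → (n : ℕ) → List (Vec A n)
vecs xs zero    = [] ∷ []
vecs xs (suc n) = cartesianProductWith _∷_ xs (vecs xs n)

∈-vecs : {xs : List A} → (∀ x → x LM.∈ xs) → (v : Vec A n) → v LM.∈ vecs xs n
∈-vecs all []      = here refl
∈-vecs all (x ∷ v) = ∈-cartesianProductWith⁺ _∷_ (all x) (∈-vecs all v)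

vecs-unique : {xs : List A} → Unique xs → ∀ n → Unique (vecs xs n)
vecs-unique u zero    = [] ∷ []
vecs-unique u (suc n) = Unique.cartesianProductWith⁺ _∷_ ∷-injective u (vecs-unique u n)

tuples : (N n : ℕ) → List (Vec (Fin N) n)
tuples N = vecs (allFin N)

subsets : (N : ℕ) → List (Subset N)
subsets = vecs (true ∷ false ∷ [])

subsets-unique : ∀ N → Unique (subsets N)
subsets-unique = vecs-unique (((λ ()) ∷ []) ∷ [] ∷ [])

∈-subsets : (S : Subset N) → S LM.∈ subsets N
∈-subsets = ∈-vecs λ { true → here refl ; false → there (here refl) }

-- Enumerations of a subset by a tuple

-- Deleting each entry as it is read encodes a bijective listing in one recursion: a repeated entry
-- is no longer a member, and what is left at the end must be empty.
Enumerates : Vec (Fin N) n → Subset N → Set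
Enumerates []      S = S ≡ Subset.⊥
Enumerates (x ∷ w) S = x ∈ S × Enumerates w (S [ x ]≔ outside)

enumerates? : (w : Vec (Fin N) n) (S : Subset N) → Dec (Enumerates w S)
enumerates? []      S = ≡-dec Bool._≟_ S Subset.⊥
enumerates? (x ∷ w) S = (x ∈? S) ×-dec enumerates? w (S [ x ]≔ outside)

∈-remove⁻ : {S : Subset N} {x y : Fin N} → y ∈ S [ x ]≔ outside → x ≢ y × y ∈ S
∈-remove⁻ {S = S} {x} {y} y∈ with x Fin.≟ y
... | yes refl = contradiction (trans (sym ([]=⇒lookup y∈)) (lookup∘update x S outside)) λ ()
... | no x≢y   = x≢y , lookup⇒[]= y S (trans (sym (lookup∘update′ (x≢y ∘ sym) S outside)) ([]=⇒lookup y∈))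

enumerates-lookup : (w : Vec (Fin N) n) {S : Subset N} → Enumerates w S → ∀ i → lookup w i ∈ S
enumerates-lookup (x ∷ w) (x∈S , e) zero    = x∈S
enumerates-lookup (x ∷ w) (x∈S , e) (suc i) = proj₂ (∈-remove⁻ (enumerates-lookup w e i))

enumerates-surjective : (w : Vec (Fin N) n) {S : Subset N} → Enumerates w S →
  ∀ {u} → u ∈ S → ∃ λ i → lookup w i ≡ u
enumerates-surjective []      refl u∈ = contradiction u∈ ∉⊥
enumerates-surjective (x ∷ w) {S} (x∈S , e) {u} u∈ with x Fin.≟ u
... | yes x≡u = zero , x≡u
... | no x≢u  = let i , eq = enumerates-surjective w e ([]≔-minimal S u x (x≢u ∘ sym) u∈) in suc i , eq

enumerates-injective : (w : Vec (Fin N) n) {S : Subset N} → Enumerates w S →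
  ∀ i j → i ≢ j → lookup w i ≢ lookup w j
enumerates-injective (x ∷ w) (_ , e) zero    zero    i≢j _  = i≢j refl
enumerates-injective (x ∷ w) (_ , e) zero    (suc j) _   eq = proj₁ (∈-remove⁻ (enumerates-lookup w e j)) eq
enumerates-injective (x ∷ w) (_ , e) (suc i) zero    _   eq = proj₁ (∈-remove⁻ (enumerates-lookup w e i)) (sym eq)
enumerates-injective (x ∷ w) (_ , e) (suc i) (suc j) i≢j eq = enumerates-injective w e i j (i≢j ∘ cong suc) eq

reinsert : {S : Subset N} {x : Fin N} → x ∈ S → S [ x ]≔ outside [ x ]≔ inside ≡ S
reinsert {S = S} {x} x∈S = begin
  S [ x ]≔ outside [ x ]≔ inside  ≡⟨ []≔-idempotent S x ⟩
  S [ x ]≔ inside                 ≡⟨ cong (S [ x ]≔_) ([]=⇒lookup x∈S) ⟨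
  S [ x ]≔ lookup S x             ≡⟨ []≔-lookup S x ⟩
  S                               ∎
  where open ≡-Reasoning

enumerates-unique : (w : Vec (Fin N) n) {S T : Subset N} → Enumerates w S → Enumerates w T → S ≡ T
enumerates-unique []      refl refl = refl
enumerates-unique (x ∷ w) (x∈S , e) (x∈T , e′) = begin
  _                         ≡⟨ reinsert x∈S ⟨
  _ [ x ]≔ inside           ≡⟨ cong (_[ x ]≔ inside) (enumerates-unique w e e′) ⟩
  _ [ x ]≔ inside           ≡⟨ reinsert x∈T ⟩
  _                         ∎
  where open ≡-Reasoning

enumerated : (w : Vec (Fin N) n) → (∀ i j → i ≢ j → lookup w i ≢ lookup w j) → ∃ (Enumerates w)
enumerated []      inj = Subset.⊥ , refl
enumerated (x ∷ w) inj =
  S [ x ]≔ inside , []≔-updates S x , subst (Enumerates w) (sym removed) e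
  where
  open ≡-Reasoning
  rec = enumerated w λ i j i≢j → inj (suc i) (suc j) (i≢j ∘ Fin.suc-injective)
  S = proj₁ rec
  e = proj₂ rec
  -- Injectivity keeps the head out of the set enumerated by the tail, so inserting and then
  -- removing it restores that set.
  x∉S : lookup S x ≡ outside
  x∉S = ¬-not λ eq → let i , eq′ = enumerates-surjective w e (lookup⇒[]= x S eq) in
    inj zero (suc i) (λ ()) (sym eq′)
  removed : S [ x ]≔ inside [ x ]≔ outside ≡ S
  removed = begin
    S [ x ]≔ inside [ x ]≔ outside  ≡⟨ []≔-idempotent S x ⟩
    S [ x ]≔ outside                ≡⟨ cong (S [ x ]≔_) x∉S ⟨
    S [ x ]≔ lookup S x             ≡⟨ []≔-lookup S x ⟩
    S                               ∎

∣remove∣ : {S : Subset N} {x : Fin N} → x ∈ S → suc ∣ S [ x ]≔ outside ∣ ≡ ∣ S ∣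
∣remove∣ here                      = refl
∣remove∣ {S = inside ∷ S}  (there x∈) = cong suc (∣remove∣ x∈)
∣remove∣ {S = outside ∷ S} (there x∈) = ∣remove∣ x∈

allFin-suc : (N : ℕ) (f : Fin (suc N) → ℕ) → ∑ (allFin (suc N)) f ≡ f zero + ∑ (allFin N) (f ∘ suc)
allFin-suc N f = cong (f zero +_)
  (trans (cong (λ xs → ∑ xs f) (sym (map-tabulate id suc))) (∑-map suc (allFin N) f))

∑-∈ : (S : Subset N) → ∑ (allFin N) (λ x → ind (x ∈? S)) ≡ ∣ S ∣
∑-∈ []      = refl
∑-∈ (b ∷ S) = trans (allFin-suc _ λ x → ind (x ∈? (b ∷ S)))
  (trans (cong (ind (zero ∈? (b ∷ S)) +_) (trans (∑-cong (allFin _) tail) (∑-∈ S))) (head b))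
  where
  tail : ∀ x → ind (suc x ∈? (b ∷ S)) ≡ ind (x ∈? S)
  tail x = ind-cong (suc x ∈? (b ∷ S)) (x ∈? S) (mk⇔ (λ { (there x∈) → x∈ }) there)
  head : ∀ b → ind (zero ∈? (b ∷ S)) + ∣ S ∣ ≡ ∣ b ∷ S ∣
  head inside  = refl
  head outside = refl

-- The head of an enumeration is any element of `S` and the tail enumerates what remains after
-- deleting it, which builds up the factorial by induction.
∑-enumerates : (n : ℕ) (S : Subset N) →
  ∑ (tuples N n) (λ w → ind (enumerates? w S)) ≡ ind (∣ S ∣ ≟ n) * n !
∑-enumerates {N} zero S = begin
  ind (enumerates? [] S) + 0  ≡⟨ +-identityʳ _ ⟩
  ind (enumerates? [] S)      ≡⟨ ind-cong (enumerates? [] S) (∣ S ∣ ≟ 0) (mk⇔ (λ { refl → ∣⊥∣≡0 N }) (empty S)) ⟩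
  ind (∣ S ∣ ≟ 0)             ≡⟨ *-identityʳ _ ⟨
  ind (∣ S ∣ ≟ 0) * 1         ∎
  where
  open ≡-Reasoning
  empty : ∀ {N} (S : Subset N) → ∣ S ∣ ≡ 0 → S ≡ Subset.⊥
  empty []            _  = refl
  empty (outside ∷ S) eq = cong (outside ∷_) (empty S eq)
∑-enumerates {N} (suc n) S = begin
  ∑ (tuples N (suc n)) (λ w → ind (enumerates? w S))
    ≡⟨ ∑-cartesianProductWith _∷_ (allFin N) (tuples N n) _ ⟩
  ∑ (allFin N) (λ x → ∑ (tuples N n) (λ w → ind ((x ∈? S) ×-dec enumerates? w (S [ x ]≔ outside))))
    ≡⟨ ∑-cong (allFin N) (λ x → trans
         (∑-cong (tuples N n) (λ w → ind-× (x ∈? S) _))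
         (*-∑ (ind (x ∈? S)) (tuples N n) _)) ⟩
  ∑ (allFin N) (λ x → ind (x ∈? S) * ∑ (tuples N n) (λ w → ind (enumerates? w (S [ x ]≔ outside))))
    ≡⟨ ∑-cong (allFin N) (λ x → cong (ind (x ∈? S) *_) (∑-enumerates n (S [ x ]≔ outside))) ⟩
  ∑ (allFin N) (λ x → ind (x ∈? S) * (ind (∣ S [ x ]≔ outside ∣ ≟ n) * n !))
    ≡⟨ ∑-cong (allFin N) step ⟩
  ∑ (allFin N) (λ x → (ind (∣ S ∣ ≟ suc n) * n !) * ind (x ∈? S))
    ≡⟨ *-∑ (ind (∣ S ∣ ≟ suc n) * n !) (allFin N) _ ⟩
  (ind (∣ S ∣ ≟ suc n) * n !) * ∑ (allFin N) (λ x → ind (x ∈? S))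
    ≡⟨ cong ((ind (∣ S ∣ ≟ suc n) * n !) *_) (∑-∈ S) ⟩
  (ind (∣ S ∣ ≟ suc n) * n !) * ∣ S ∣
    ≡⟨ factorial ⟩
  ind (∣ S ∣ ≟ suc n) * (suc n) ! ∎
  where
  open ≡-Reasoning
  -- Off `S` both sides vanish; on `S` the deletion of `x` lowers the cardinality by one, so the two
  -- size tests agree.
  step : ∀ x → ind (x ∈? S) * (ind (∣ S [ x ]≔ outside ∣ ≟ n) * n !) ≡
           (ind (∣ S ∣ ≟ suc n) * n !) * ind (x ∈? S)
  step x with x ∈? S
  ... | no _    = sym (*-zeroʳ (ind (∣ S ∣ ≟ suc n) * n !))
  ... | yes x∈S = begin
    1 * (ind (∣ S [ x ]≔ outside ∣ ≟ n) * n !)  ≡⟨ *-comm 1 _ ⟩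
    ind (∣ S [ x ]≔ outside ∣ ≟ n) * n ! * 1
      ≡⟨ cong (λ c → c * n ! * 1) (ind-cong (∣ S [ x ]≔ outside ∣ ≟ n) (∣ S ∣ ≟ suc n)
           (mk⇔ (λ eq → trans (sym (∣remove∣ x∈S)) (cong suc eq))
                (λ eq → suc-injective (trans (∣remove∣ x∈S) eq)))) ⟩
    ind (∣ S ∣ ≟ suc n) * n ! * 1 ∎
  factorial : (ind (∣ S ∣ ≟ suc n) * n !) * ∣ S ∣ ≡ ind (∣ S ∣ ≟ suc n) * (suc n) !
  factorial with ∣ S ∣ ≟ suc n
  ... | no _   = refl
  ... | yes eq = trans (cong (1 * n ! *_) eq) (rearrange (n !) (suc n))
    where
    rearrange : ∀ a b → 1 * a * b ≡ 1 * (b * a)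
    rearrange = solve-∀

-- Independent sets and their ordered listings.

-- Equality is forbidden together with adjacency, so that a spread tuple is injective and hence
-- enumerates a set.
Spread : Graph N → Vec (Fin N) n → Set
Spread G w = ∀ i j → i ≢ j → ¬ (lookup w i ≡ lookup w j ⊎ Adj G (lookup w i) (lookup w j))

spread⇔independent : {G : Graph N} → (∀ u → ¬ Adj G u u) → (w : Vec (Fin N) n) {S : Subset N} →
  Enumerates w S → Spread G w ⇔ Independent G S
spread⇔independent {G = G} irrefl w {S} e = mk⇔ ⇒ ⇐
  where
  ⇒ : Spread G w → Independent G S
  ⇒ spread u v u∈S v∈S with enumerates-surjective w e u∈S | enumerates-surjective w e v∈S
  ... | i , refl | j , refl with i Fin.≟ j
  -- `Independent` also compares a vertex with itself; there irreflexivity of the graph decides.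
  ...   | yes refl = irrefl _
  ...   | no i≢j   = spread i j i≢j ∘ inj₂
  ⇐ : Independent G S → Spread G w
  ⇐ indep i j i≢j (inj₁ eq)  = enumerates-injective w e i j i≢j eq
  ⇐ indep i j i≢j (inj₂ adj) = indep _ _ (enumerates-lookup w e i) (enumerates-lookup w e j) adj

module _ (G : Graph N) (adj? : ∀ u v → Dec (Adj G u v)) where

  independent? : (S : Subset N) → Dec (Independent G S)
  independent? S = Fin.all? λ u → Fin.all? λ v → (u ∈? S) →-dec ((v ∈? S) →-dec ¬? (adj? u v))

  -- Double counting of the pairs of a tuple `w` and an independent set `S` enumerated by `w`: a
  -- spread tuple lies in exactly one pair and any other tuple in none, while an independent `n`-set
  -- lies in `n !` pairs.
  ∑-spread : (∀ u → ¬ Adj G u u) → (spread? : (w : Vec (Fin N) n) → Dec (Spread G w)) →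
    ∑ (tuples N n) (λ w → ind (spread? w)) ≡
    ∑ (subsets N) (λ S → ind (independent? S ×-dec (∣ S ∣ ≟ n))) * n !
  ∑-spread {n} irrefl spread? = begin
    ∑ (tuples N n) (λ w → ind (spread? w))
      ≡⟨ ∑-cong (tuples N n) (sym ∘ fibre) ⟩
    ∑ (tuples N n) (λ w → ∑ (subsets N) (λ S → ind (enumerates? w S) * ind (independent? S)))
      ≡⟨ ∑-swap (tuples N n) (subsets N) _ ⟩
    ∑ (subsets N) (λ S → ∑ (tuples N n) (λ w → ind (enumerates? w S) * ind (independent? S)))
      ≡⟨ ∑-cong (subsets N) (λ S → begin
        ∑ (tuples N n) (λ w → ind (enumerates? w S) * ind (independent? S))
          ≡⟨ ∑-cong (tuples N n) (λ w → *-comm (ind (enumerates? w S)) _) ⟩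
        ∑ (tuples N n) (λ w → ind (independent? S) * ind (enumerates? w S))
          ≡⟨ *-∑ (ind (independent? S)) (tuples N n) _ ⟩
        ind (independent? S) * ∑ (tuples N n) (λ w → ind (enumerates? w S))
          ≡⟨ cong (ind (independent? S) *_) (∑-enumerates n S) ⟩
        ind (independent? S) * (ind (∣ S ∣ ≟ n) * n !)
          ≡⟨ *-assoc (ind (independent? S)) _ _ ⟨
        ind (independent? S) * ind (∣ S ∣ ≟ n) * n !
          ≡⟨ cong (_* n !) (ind-× (independent? S) _) ⟨
        ind (independent? S ×-dec (∣ S ∣ ≟ n)) * n !
          ≡⟨ *-comm _ (n !) ⟩
        n ! * ind (independent? S ×-dec (∣ S ∣ ≟ n)) ∎) ⟩
    ∑ (subsets N) (λ S → n ! * ind (independent? S ×-dec (∣ S ∣ ≟ n)))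
      ≡⟨ *-∑ (n !) (subsets N) _ ⟩
    n ! * ∑ (subsets N) (λ S → ind (independent? S ×-dec (∣ S ∣ ≟ n)))
      ≡⟨ *-comm (n !) _ ⟩
    ∑ (subsets N) (λ S → ind (independent? S ×-dec (∣ S ∣ ≟ n))) * n ! ∎
    where
    open ≡-Reasoning
    fibre : ∀ w → ∑ (subsets N) (λ S → ind (enumerates? w S) * ind (independent? S)) ≡ ind (spread? w)
    fibre w with spread? w
    ... | yes spread with enumerated w (λ i j i≢j → spread i j i≢j ∘ inj₁)
    ...   | S , e = trans
      (∑-select (enumerates? w) (ind ∘ independent?) (subsets-unique N) (∈-subsets S) e
        (λ e′ → enumerates-unique w e′ e))
      (ind-yes (independent? S) (to (spread⇔independent irrefl w e) spread))
    fibre w | no ¬spread = ∑-zero (subsets N) λ S → trans (sym (ind-× (enumerates? w S) (independent? S)))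
      (ind-no (enumerates? w S ×-dec independent? S) λ (e , indep) →
        ¬spread (from (spread⇔independent irrefl w e) indep))

  independentSets : (n : ℕ) → NumIndepSets≡ G n (∑ (subsets N) (λ S → ind (independent? S ×-dec (∣ S ∣ ≟ n))))
  independentSets n =
    filter good? (subsets N) ,
    Unique.filter⁺ good? (subsets-unique N) ,
    (λ S → mk⇔ (λ S∈ → proj₂ (∈-filter⁻ good? {xs = subsets N} S∈)) (∈-filter⁺ good? (∈-subsets S))) ,
    length-filter good? (subsets N)
    where
    good? : (S : Subset N) → Dec (Independent G S × ∣ S ∣ ≡ n)
    good? S = independent? S ×-dec (∣ S ∣ ≟ n)

-- Shifts and systems of constraints.

-- (p , q) stands for the exponent vector p − q ∈ ℤ^m.
Shift : ℕ → Set
Shift m = Vec ℕ m × Vec ℕ m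

infixl 6 _⊹_

_⊹_ : Shift m → Shift m → Shift m
(p , q) ⊹ (p′ , q′) = zipWith _+_ p p′ , zipWith _+_ q q′

0ˢ : Shift m
0ˢ = replicate _ 0 , replicate _ 0

Null : Shift m → Set
Null (p , q) = p ≡ q

null? : (g : Shift m) → Dec (Null g)
null? (p , q) = ≡-dec _≟_ p q

-- (i , g , j) is the condition w_i ≠ g w_j on a tuple w of c vertices.
Constraint : ℕ → ℕ → Set
Constraint m c = Fin c × Shift m × Fin c

-- place i≢j g x = (h , y) when w_x = h w′_y, where w is obtained from the c-tuple w′ by inserting
-- w_i := g w_j.
place : {i j : Fin (suc c)} → i ≢ j → Shift m → Fin (suc c) → Shift m × Fin c
place {i = i} i≢j g x with i Fin.≟ x
... | yes _  = g , punchOut i≢j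
... | no i≢x = 0ˢ , punchOut i≢x

-- With `w_x = gx w′_x′` and `w_y = gy w′_y′`, the condition `w_x ≠ h w_y` becomes
-- `w′_x′ ≠ gx⁻¹ h gy w′_y′`; `swap` negates an exponent vector and so provides the inverse.
contract : {i j : Fin (suc c)} → i ≢ j → Shift m → Constraint m (suc c) → Constraint m c
contract i≢j g (x , h , y) =
  let (gx , x′) = place i≢j g x
      (gy , y′) = place i≢j g y
  in x′ , swap gx ⊹ (h ⊹ gy) , y′

-- Deletion and contraction; this is the number of solutions in a K-element vertex set on which the
-- shifts listed in needed act freely.
count : ℕ → Vec (Constraint m c) l → ℕ
count {c = c} K [] = K ^ c
count {c = suc c} K ((i , g , j) ∷ cs) with i Fin.≟ j
... | no i≢j = count K cs ∸ count K (Vec.map (contract i≢j g) cs)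
... | yes _ with null? g
...   | yes _ = 0
...   | no _  = count K cs

-- The shifts on loops met by the recursion of `count`. They depend on the constraints alone, so
-- they are known before any graph is chosen. Null shifts are listed too, but for them `Free` is
-- vacuous.
needed : Vec (Constraint m c) l → List (Shift m)
needed [] = []
needed {c = suc c} ((i , g , j) ∷ cs) with i Fin.≟ j
... | no i≢j = needed cs ++ needed (Vec.map (contract i≢j g) cs)
... | yes _  = g ∷ needed cs

-- Actions of shifts and transport of constraints.

-- An action of `ℤ^m` without forming a quotient: `act-null` makes every representative of the zero
-- vector act trivially, and with `act-⊹` this turns `swap g` into the inverse of `g`.
record Action (m N : ℕ) : Set where
  field
    act      : Shift m → Fin N → Fin N
    act-⊹    : ∀ g h v → act (g ⊹ h) v ≡ act g (act h v)
    act-null : ∀ p v → act (p , p) v ≡ v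

  Free : Shift m → Set
  Free g = ¬ Null g → ∀ v → act g v ≢ v

  act-inverseˡ : ∀ g v → act (swap g) (act g v) ≡ v
  act-inverseˡ (p , q) v = begin
    act (q , p) (act (p , q) v)             ≡⟨ act-⊹ (q , p) (p , q) v ⟨
    act (zipWith _+_ q p , zipWith _+_ p q) v
      ≡⟨ cong (λ r → act (zipWith _+_ q p , r) v) (zipWith-comm +-comm p q) ⟩
    act (zipWith _+_ q p , zipWith _+_ q p) v ≡⟨ act-null _ v ⟩
    v ∎
    where open ≡-Reasoning

  act-transpose : ∀ g {u v} → act g u ≡ v ⇔ u ≡ act (swap g) v
  act-transpose g = mk⇔ (λ { refl → sym (act-inverseˡ g _) }) (λ { refl → act-inverseˡ (swap g) _ })

  Holds : Vec (Fin N) c → Constraint m c → Set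
  Holds w (i , g , j) = lookup w i ≢ act g (lookup w j)

  holds? : (w : Vec (Fin N) c) (C : Constraint m c) → Dec (Holds w C)
  holds? w (i , g , j) = ¬? (lookup w i Fin.≟ act g (lookup w j))

  Sat : Vec (Constraint m c) l → Vec (Fin N) c → Set
  Sat cs w = AllV (Holds w) cs

  sat? : (cs : Vec (Constraint m c) l) (w : Vec (Fin N) c) → Dec (Sat cs w)
  sat? cs w = VecAll.all? (holds? w) cs

  module _ {i j : Fin (suc c)} (i≢j : i ≢ j) (g : Shift m) (w : Vec (Fin N) c) where

    expand : Vec (Fin N) (suc c)
    expand = insertAt w i (act g (lookup w (punchOut i≢j)))

    lookup-punchOut : ∀ {x y} (i≢x : i ≢ x) → lookup (insertAt w i y) x ≡ lookup w (punchOut i≢x)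
    lookup-punchOut {x} {y} i≢x = begin
      lookup (insertAt w i y) x                          ≡⟨ cong (lookup (insertAt w i y)) (Fin.punchIn-punchOut i≢x) ⟨
      lookup (insertAt w i y) (punchIn i (punchOut i≢x)) ≡⟨ insertAt-punchIn w i y _ ⟩
      lookup w (punchOut i≢x)                            ∎
      where open ≡-Reasoning

    lookup-expand : ∀ x → let (h , x′) = place i≢j g x in lookup expand x ≡ act h (lookup w x′)
    lookup-expand x with i Fin.≟ x
    ... | yes refl = insertAt-lookup w i _
    ... | no i≢x   = trans (lookup-punchOut i≢x) (sym (act-null _ _))

    -- The shift `gx` acts invertibly, so it can be carried across the equation that the constraint
    -- forbids.
    holds-expand : ∀ C → Holds expand C ⇔ Holds w (contract i≢j g C)
    holds-expand (x , h , y) = mk⇔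
      (λ ≢ eq → ≢ (begin
        lookup expand x                     ≡⟨ lookup-expand x ⟩
        act gx (lookup w x′)                ≡⟨ from (act-transpose gx) (trans eq step) ⟩
        act h (lookup expand y)             ∎))
      (λ ≢ eq → ≢ (trans (to (act-transpose gx) (trans (sym (lookup-expand x)) eq)) (sym step)))
      where
      open ≡-Reasoning
      gx = proj₁ (place i≢j g x)
      x′ = proj₂ (place i≢j g x)
      gy = proj₁ (place i≢j g y)
      y′ = proj₂ (place i≢j g y)
      step : act (swap gx ⊹ (h ⊹ gy)) (lookup w y′) ≡ act (swap gx) (act h (lookup expand y))
      step = begin
        act (swap gx ⊹ (h ⊹ gy)) (lookup w y′)      ≡⟨ act-⊹ (swap gx) (h ⊹ gy) _ ⟩
        act (swap gx) (act (h ⊹ gy) (lookup w y′))  ≡⟨ cong (act (swap gx)) (act-⊹ h gy _) ⟩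
        act (swap gx) (act h (act gy (lookup w y′))) ≡⟨ cong (act (swap gx) ∘ act h) (lookup-expand y) ⟨
        act (swap gx) (act h (lookup expand y))     ∎

    sat-expand : (cs : Vec (Constraint m (suc c)) l) → Sat cs expand ⇔ Sat (Vec.map (contract i≢j g) cs) w
    sat-expand cs = mk⇔
      (λ s → VecAll.map⁺ (VecAll.map (λ {C} → to (holds-expand C)) s))
      (λ s → VecAll.map (λ {C} → from (holds-expand C)) (VecAll.map⁻ s))

-- Counting solutions by deletion and contraction.

-- Makes the coordinate to be eliminated the innermost summation variable, wherever it stands in the
-- tuple.
∑-insertAt : (i : Fin (suc c)) (f : Vec (Fin N) (suc c) → ℕ) →
  ∑ (tuples N (suc c)) f ≡ ∑ (tuples N c) (λ w → ∑ (allFin N) (λ x → f (insertAt w i x)))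
∑-insertAt {c} {N} zero f =
  trans (∑-cartesianProductWith _∷_ (allFin N) (tuples N c) f) (∑-swap (allFin N) (tuples N c) _)
∑-insertAt {suc c} {N} (suc i) f = begin
  ∑ (tuples N (suc (suc c))) f
    ≡⟨ ∑-cartesianProductWith _∷_ (allFin N) (tuples N (suc c)) f ⟩
  ∑ (allFin N) (λ y → ∑ (tuples N (suc c)) (λ w → f (y ∷ w)))
    ≡⟨ ∑-cong (allFin N) (λ y → ∑-insertAt i (λ w → f (y ∷ w))) ⟩
  ∑ (allFin N) (λ y → ∑ (tuples N c) (λ w → ∑ (allFin N) (λ x → f (y ∷ insertAt w i x))))
    ≡⟨ ∑-cartesianProductWith _∷_ (allFin N) (tuples N c) _ ⟨
  ∑ (tuples N (suc c)) (λ w → ∑ (allFin N) (λ x → f (insertAt w (suc i) x))) ∎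
  where open ≡-Reasoning

∑-tuples-1 : (N c : ℕ) → ∑ (tuples N c) (λ _ → 1) ≡ N ^ c
∑-tuples-1 N zero    = refl
∑-tuples-1 N (suc c) = begin
  ∑ (tuples N (suc c)) (λ _ → 1)               ≡⟨ ∑-cartesianProductWith _∷_ (allFin N) (tuples N c) _ ⟩
  ∑ (allFin N) (λ _ → ∑ (tuples N c) (λ _ → 1)) ≡⟨ ∑-const (allFin N) _ ⟩
  length (allFin N) * ∑ (tuples N c) (λ _ → 1)  ≡⟨ cong₂ _*_ (length-tabulate {n = N} id) (∑-tuples-1 N c) ⟩
  N * N ^ c                                     ∎
  where open ≡-Reasoning

module _ (A : Action m N) where
  open Action A

  -- Induction on the number of constraints: contraction changes the remaining constraints but not
  -- how many there are. Freeness enters only at loops.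
  ∑-sat : (cs : Vec (Constraint m c) l) → All Free (needed cs) →
    ∑ (tuples N c) (λ w → ind (sat? cs w)) ≡ count N cs
  ∑-sat {c = c} [] _ = ∑-tuples-1 N c
  ∑-sat {c = suc c} ((i , g , j) ∷ cs) free with i Fin.≟ j
  ... | yes refl with null? g
  -- A loop with a null shift demands `w_i ≠ w_i`.
  ...   | yes refl = ∑-zero (tuples N (suc c)) λ w →
            ind-no (sat? ((i , g , i) ∷ cs) w) λ { (≢ ∷ _) → ≢ (sym (act-null _ _)) }
  ...   | no nonnull = trans
            (∑-cong (tuples N (suc c)) λ w → ind-cong (sat? ((i , g , i) ∷ cs) w) (sat? cs w)
              (mk⇔ (λ { (_ ∷ s) → s }) ((All.head free nonnull _ ∘ sym) ∷_)))
            (∑-sat cs (All.tail free))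
  ∑-sat {c = suc c} ((i , g , j) ∷ cs) free | no i≢j = begin
    ∑ (tuples N (suc c)) (λ w → ind (sat? ((i , g , j) ∷ cs) w))
      -- Subtraction truncates, so the tuples violating the head constraint are first added and then
      -- removed; no inequality has to be checked.
      ≡⟨ m+n∸n≡m _ (∑ (tuples N (suc c)) meets) ⟨
    ∑ (tuples N (suc c)) (λ w → ind (sat? ((i , g , j) ∷ cs) w)) + ∑ (tuples N (suc c)) meets
      ∸ ∑ (tuples N (suc c)) meets
      ≡⟨ cong₂ _∸_ (sym (∑-+ (tuples N (suc c)) _ meets)) contracted ⟩
    ∑ (tuples N (suc c)) (λ w → ind (sat? ((i , g , j) ∷ cs) w) + meets w)
      ∸ count N (Vec.map (contract i≢j g) cs)
      ≡⟨ cong (_∸ count N (Vec.map (contract i≢j g) cs))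
           (trans (∑-cong (tuples N (suc c)) split) (∑-sat cs (All.++⁻ˡ (needed cs) free))) ⟩
    count N cs ∸ count N (Vec.map (contract i≢j g) cs) ∎
    where
    open ≡-Reasoning
    meets? : ∀ w → Dec (lookup w i ≡ act g (lookup w j))
    meets? w = lookup w i Fin.≟ act g (lookup w j)
    meets : Vec (Fin N) (suc c) → ℕ
    meets w = ind (meets? w) * ind (sat? cs w)
    split : ∀ w → ind (sat? ((i , g , j) ∷ cs) w) + meets w ≡ ind (sat? cs w)
    split w = begin
      ind (sat? ((i , g , j) ∷ cs) w) + meets w
        ≡⟨ cong (_+ meets w) (trans (ind-cong (sat? ((i , g , j) ∷ cs) w) (¬? (meets? w) ×-dec sat? cs w)
             (mk⇔ (λ { (h ∷ s) → h , s }) (λ (h , s) → h ∷ s))) (ind-× (¬? (meets? w)) (sat? cs w))) ⟩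
      ind (¬? (meets? w)) * ind (sat? cs w) + meets w
        ≡⟨ *-distribʳ-+ (ind (sat? cs w)) (ind (¬? (meets? w))) _ ⟨
      (ind (¬? (meets? w)) + ind (meets? w)) * ind (sat? cs w)
        ≡⟨ cong (_* ind (sat? cs w)) (trans (+-comm (ind (¬? (meets? w))) _) (ind-split (meets? w))) ⟩
      1 * ind (sat? cs w)
        ≡⟨ *-identityˡ _ ⟩
      ind (sat? cs w) ∎
    -- As `i ≢ j`, the entry at `j` is read from `w` and does not involve the inserted `x`.
    meets-insertAt : ∀ w x → meets (insertAt w i x) ≡
      ind (x Fin.≟ act g (lookup w (punchOut i≢j))) * ind (sat? cs (insertAt w i x))
    meets-insertAt w x = cong (_* ind (sat? cs (insertAt w i x)))
      (cong₂ (λ u v → ind (u Fin.≟ act g v)) (insertAt-lookup w i x) (lookup-punchOut i≢j g w i≢j))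
    contracted : ∑ (tuples N (suc c)) meets ≡ count N (Vec.map (contract i≢j g) cs)
    contracted = begin
      ∑ (tuples N (suc c)) meets
        ≡⟨ ∑-insertAt i meets ⟩
      ∑ (tuples N c) (λ w → ∑ (allFin N) (λ x → meets (insertAt w i x)))
        -- The violated constraint forces the inserted value, so the inner sum has a single
        -- surviving term, at `expand i≢j g w`.
        ≡⟨ ∑-cong (tuples N c) (λ w → trans (∑-cong (allFin N) (meets-insertAt w))
             (∑-select (Fin._≟ act g (lookup w (punchOut i≢j))) (λ x → ind (sat? cs (insertAt w i x)))
               (Unique.allFin⁺ N) (∈-allFin _) refl id)) ⟩
      ∑ (tuples N c) (λ w → ind (sat? cs (expand i≢j g w)))
        ≡⟨ ∑-cong (tuples N c) (λ w → ind-cong (sat? cs (expand i≢j g w))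
             (sat? (Vec.map (contract i≢j g) cs) w) (sat-expand i≢j g w cs)) ⟩
      ∑ (tuples N c) (λ w → ind (sat? (Vec.map (contract i≢j g) cs) w))
        ≡⟨ ∑-sat (Vec.map (contract i≢j g) cs) (All.++⁻ʳ (needed cs) free) ⟩
      count N (Vec.map (contract i≢j g) cs) ∎

-- Spread tuples as solutions of a constraint system.

basis : Fin m → Shift m
basis r = replicate _ 0 [ r ]≔ 1 , replicate _ 0

-- The zero shift accounts for equality, and `basis r` and its inverse for the two orientations of
-- an edge.
steps : (m : ℕ) → List (Shift m)
steps m = 0ˢ ∷ map basis (allFin m) ++ map (swap ∘ basis) (allFin m)

distinctPair? : (C : Constraint m n) → Dec (proj₁ C ≢ proj₂ (proj₂ C))
distinctPair? (i , _ , j) = ¬? (i Fin.≟ j)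

-- No loops occur at the start; they arise only through contraction.
constraints : (m n : ℕ) → List (Constraint m n)
constraints m n = filter distinctPair? (cartesianProduct (allFin n) (cartesianProduct (steps m) (allFin n)))

system : (m n : ℕ) → Vec (Constraint m n) (length (constraints m n))
system m n = Vec.fromList (constraints m n)

module _ (A : Action m N) where
  open Action A

  Neighbours : Fin N → Fin N → Set
  Neighbours u v = u ≢ v × ∃ λ r → u ≡ act (basis r) v ⊎ v ≡ act (basis r) u

  neighbours? : ∀ u v → Dec (Neighbours u v)
  neighbours? u v = ¬? (u Fin.≟ v) ×-dec
    Fin.any? λ r → (u Fin.≟ act (basis r) v) ⊎-dec (v Fin.≟ act (basis r) u)

  close⇒step : ∀ {u v} → u ≡ v ⊎ Neighbours u v → ∃ λ s → s LM.∈ steps m × u ≡ act s v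
  close⇒step (inj₁ refl)             = 0ˢ , here refl , sym (act-null _ _)
  close⇒step (inj₂ (_ , r , inj₁ eq)) = basis r , there (∈-++⁺ˡ (∈-map⁺ basis (∈-allFin r))) , eq
  close⇒step (inj₂ (_ , r , inj₂ eq)) =
    swap (basis r) , there (∈-++⁺ʳ (map basis (allFin m)) (∈-map⁺ (swap ∘ basis) (∈-allFin r))) ,
    to (act-transpose (basis r)) (sym eq)

  step⇒close : ∀ {u v s} → s LM.∈ steps m → u ≡ act s v → u ≡ v ⊎ Neighbours u v
  step⇒close (here refl) eq = inj₁ (trans eq (act-null _ _))
  -- No freeness is assumed here, so a step might fix a vertex; equality is decided first because
  -- `Neighbours` excludes it.
  step⇒close {u} {v} (there s∈) eq with u Fin.≟ v
  ... | yes u≡v = inj₁ u≡v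
  ... | no u≢v with ∈-++⁻ (map basis (allFin m)) s∈
  ...   | inj₁ s∈ with r , _ , refl ← ∈-map⁻ basis s∈           = inj₂ (u≢v , r , inj₁ eq)
  ...   | inj₂ s∈ with r , _ , refl ← ∈-map⁻ (swap ∘ basis) s∈ =
    inj₂ (u≢v , r , inj₂ (sym (from (act-transpose (basis r)) eq)))

  sat⇔spread : (w : Vec (Fin N) n) →
    Sat (system m n) w ⇔ (∀ i j → i ≢ j → ¬ (lookup w i ≡ lookup w j ⊎ Neighbours (lookup w i) (lookup w j)))
  sat⇔spread {n} w = mk⇔
    (λ sat i j i≢j close → let s , s∈ , eq = close⇒step close in
      All.lookup (VecAll.fromList⁻ sat)
        (∈-filter⁺ distinctPair? (∈-cartesianProduct⁺ (∈-allFin i) (∈-cartesianProduct⁺ s∈ (∈-allFin j))) i≢j) eq)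
    (λ spread → VecAll.fromList⁺ (All.tabulate λ {(i , s , j)} C∈ eq →
      let C∈product , i≢j = ∈-filter⁻ distinctPair? C∈
          s∈ = proj₁ (∈-cartesianProduct⁻ (steps m) (allFin n) (proj₂ (∈-cartesianProduct⁻ (allFin n) _ C∈product)))
      in spread i j i≢j (step⇒close s∈ eq)))

-- Graphs given by an action, and their independent sets.

-- All that the count uses of a graph. Freeness is required only on the finite list `gs`, since on a
-- finite vertex set no action of `ℤ^m` with `m` positive and a vertex present is free throughout.
record GridLike (gs : List (Shift m)) (G : Graph N) : Set where
  field
    action : Action m N
    free   : All (Action.Free action) gs
    adj⇔   : ∀ u v → Adj G u v ⇔ Neighbours action u v

-- The division is exact whenever `K` is the size of a graph that is `GridLike` for
-- `needed (system m n)`.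
indepCount : ℕ → ℕ → ℕ → ℕ
indepCount n m K = (count K (system m n) / n !) {{n !≢0}}

gridLike-numIndepSets : (n : ℕ) {G : Graph N} → GridLike (needed (system m n)) G →
  NumIndepSets≡ G n (indepCount n m N)
gridLike-numIndepSets {N} {m} n {G} grid = subst (NumIndepSets≡ G n) (sym eq) (independentSets G adj? n)
  where
  open GridLike grid
  open Action action
  open ≡-Reasoning
  -- `Adj` is an arbitrary family of types; its decidability is inherited from the action.
  adj? : ∀ u v → Dec (Adj G u v)
  adj? u v = map′ (from (adj⇔ u v)) (to (adj⇔ u v)) (neighbours? action u v)
  irrefl : ∀ u → ¬ Adj G u u
  irrefl u adj = proj₁ (to (adj⇔ u u) adj) refl
  sat⇔ : (w : Vec (Fin N) n) → Sat (system m n) w ⇔ Spread G w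
  sat⇔ w = mk⇔
    (λ sat i j i≢j → to (sat⇔spread action w) sat i j i≢j ∘ Sum.map₂ (to (adj⇔ _ _)))
    (λ spread → from (sat⇔spread action w) λ i j i≢j → spread i j i≢j ∘ Sum.map₂ (from (adj⇔ _ _)))
  spread? : (w : Vec (Fin N) n) → Dec (Spread G w)
  spread? w = map′ (to (sat⇔ w)) (from (sat⇔ w)) (sat? (system m n) w)
  total = ∑ (subsets N) (λ S → ind (independent? G adj? S ×-dec (∣ S ∣ ≟ n)))
  eq : indepCount n m N ≡ total
  eq = begin
    (count N (system m n) / n !) {{n !≢0}}
      ≡⟨ cong (λ c → (c / n !) {{n !≢0}}) (∑-sat action (system m n) free) ⟨
    (∑ (tuples N n) (λ w → ind (sat? (system m n) w)) / n !) {{n !≢0}}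
      ≡⟨ cong (λ c → (c / n !) {{n !≢0}}) (∑-cong (tuples N n) λ w →
           ind-cong (sat? (system m n) w) (spread? w) (sat⇔ w)) ⟩
    (∑ (tuples N n) (λ w → ind (spread? w)) / n !) {{n !≢0}}
      ≡⟨ cong (λ c → (c / n !) {{n !≢0}}) (∑-spread G adj? irrefl spread?) ⟩
    (total * n ! / n !) {{n !≢0}}
      ≡⟨ m*n/n≡m total (n !) {{n !≢0}} ⟩
    total ∎

-- The empty graph and disjoint unions.

emptyGraph-gridLike : (gs : List (Shift m)) → GridLike gs emptyGraph
emptyGraph-gridLike gs = record
  { action = record { act = λ _ () ; act-⊹ = λ _ _ () ; act-null = λ _ () }
  ; free   = All.universal (λ _ _ ()) gs
  ; adj⇔   = λ ()
  }

module _ {gs : List (Shift m)} {G : Graph N} {H : Graph N′} (g : GridLike gs G) (h : GridLike gs H) where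
  private
    module G = GridLike g
    module H = GridLike h
    module AG = Action G.action
    module AH = Action H.action

  act⊎ : Shift m → Fin N ⊎ Fin N′ → Fin N ⊎ Fin N′
  act⊎ s = Sum.map (AG.act s) (AH.act s)

  act⊕ : Shift m → Fin (N + N′) → Fin (N + N′)
  act⊕ s = join N N′ ∘ act⊎ s ∘ splitAt N

  splitAt-act⊕ : ∀ s v → splitAt N (act⊕ s v) ≡ act⊎ s (splitAt N v)
  splitAt-act⊕ s v = Fin.splitAt-join N N′ (act⊎ s (splitAt N v))

  splitAt-injective : ∀ {u v} → splitAt N u ≡ splitAt N {N′} v → u ≡ v
  splitAt-injective {u} {v} eq = begin
    u                        ≡⟨ Fin.join-splitAt N N′ u ⟨
    join N N′ (splitAt N u)  ≡⟨ cong (join N N′) eq ⟩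
    join N N′ (splitAt N v)  ≡⟨ Fin.join-splitAt N N′ v ⟩
    v                        ∎
    where open ≡-Reasoning

  action⊕ : Action m (N + N′)
  action⊕ = record
    { act      = act⊕
    ; act-⊹    = λ s t v → splitAt-injective (begin
        splitAt N (act⊕ (s ⊹ t) v)        ≡⟨ splitAt-act⊕ (s ⊹ t) v ⟩
        act⊎ (s ⊹ t) (splitAt N v)        ≡⟨ act⊎-⊹ s t (splitAt N v) ⟩
        act⊎ s (act⊎ t (splitAt N v))     ≡⟨ cong (act⊎ s) (splitAt-act⊕ t v) ⟨
        act⊎ s (splitAt N (act⊕ t v))     ≡⟨ splitAt-act⊕ s (act⊕ t v) ⟨
        splitAt N (act⊕ s (act⊕ t v))     ∎)
    ; act-null = λ p v → splitAt-injective (trans (splitAt-act⊕ (p , p) v) (act⊎-null p (splitAt N v)))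
    }
    where
    open ≡-Reasoning
    act⊎-⊹ : ∀ s t x → act⊎ (s ⊹ t) x ≡ act⊎ s (act⊎ t x)
    act⊎-⊹ s t (inj₁ v) = cong inj₁ (AG.act-⊹ s t v)
    act⊎-⊹ s t (inj₂ v) = cong inj₂ (AH.act-⊹ s t v)
    act⊎-null : ∀ p x → act⊎ (p , p) x ≡ x
    act⊎-null p (inj₁ v) = cong inj₁ (AG.act-null p v)
    act⊎-null p (inj₂ v) = cong inj₂ (AH.act-null p v)

  -- Adjacency on the sum type, as a stage between `Adj (G ⊕ H)` and `Neighbours action⊕`: one
  -- comparison then deals only with `splitAt`, the other only with the two summands.
  Neighbours⊎ : Fin N ⊎ Fin N′ → Fin N ⊎ Fin N′ → Set
  Neighbours⊎ x y = x ≢ y × ∃ λ r → x ≡ act⊎ (basis r) y ⊎ y ≡ act⊎ (basis r) x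

  neighbours⊕⇔ : ∀ u v → Neighbours⊎ (splitAt N u) (splitAt N v) ⇔ Neighbours action⊕ u v
  neighbours⊕⇔ u v = mk⇔
    (λ (≢ , r , eq) → ≢ ∘ cong (splitAt N) , r , Sum.map (join≡ u v) (join≡ v u) eq)
    (λ (≢ , r , eq) → ≢ ∘ splitAt-injective , r , Sum.map (split≡ u v) (split≡ v u) eq)
    where
    join≡ : ∀ {s} u v → splitAt N u ≡ act⊎ s (splitAt N v) → u ≡ act⊕ s v
    join≡ u v eq = splitAt-injective (trans eq (sym (splitAt-act⊕ _ v)))
    split≡ : ∀ {s} u v → u ≡ act⊕ s v → splitAt N u ≡ act⊎ s (splitAt N v)
    split≡ u v eq = trans (cong (splitAt N) eq) (splitAt-act⊕ _ v)

  adj⊕⇔ : ∀ u v → Adj (G ⊕ H) u v ⇔ Neighbours⊎ (splitAt N u) (splitAt N v)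
  adj⊕⇔ u v with splitAt N u | splitAt N v
  ... | inj₁ i | inj₁ j = mk⇔
    (λ adj → let ≢ , r , eq = to (G.adj⇔ i j) adj in
      ≢ ∘ inj₁-injective , r , Sum.map (cong inj₁) (cong inj₁) eq)
    (λ (≢ , r , eq) → from (G.adj⇔ i j)
      (≢ ∘ cong inj₁ , r , Sum.map inj₁-injective inj₁-injective eq))
  ... | inj₂ i | inj₂ j = mk⇔
    (λ adj → let ≢ , r , eq = to (H.adj⇔ i j) adj in
      ≢ ∘ inj₂-injective , r , Sum.map (cong inj₂) (cong inj₂) eq)
    (λ (≢ , r , eq) → from (H.adj⇔ i j)
      (≢ ∘ cong inj₂ , r , Sum.map inj₂-injective inj₂-injective eq))
  -- `act⊎` preserves the summand, so no shift leads from one graph to the other.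
  ... | inj₁ i | inj₂ j = mk⇔ (λ ()) (λ { (_ , _ , inj₁ ()) ; (_ , _ , inj₂ ()) })
  ... | inj₂ i | inj₁ j = mk⇔ (λ ()) (λ { (_ , _ , inj₁ ()) ; (_ , _ , inj₂ ()) })

  ⊕-gridLike : GridLike gs (G ⊕ H)
  ⊕-gridLike = record
    { action = action⊕
    ; free   = All.zipWith (λ (fG , fH) → free⊕ fG fH) (G.free , H.free)
    ; adj⇔   = λ u v → mk⇔
        (to (neighbours⊕⇔ u v) ∘ to (adj⊕⇔ u v))
        (from (adj⊕⇔ u v) ∘ from (neighbours⊕⇔ u v))
    }
    where
    free⊕ : ∀ {s} → AG.Free s → AH.Free s → Action.Free action⊕ s
    free⊕ {s} fG fH nonnull v eq = moved (splitAt N v) (trans (sym (splitAt-act⊕ s v)) (cong (splitAt N) eq))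
      where
      moved : ∀ x → act⊎ s x ≢ x
      moved (inj₁ v) eq = fG nonnull v (inj₁-injective eq)
      moved (inj₂ v) eq = fH nonnull v (inj₂-injective eq)

-- Monomials and multiplicative independence.

prodFin-cong : {f g : Fin m → ℕ} → (∀ i → f i ≡ g i) → prodFin m f ≡ prodFin m g
prodFin-cong {zero}  e = refl
prodFin-cong {suc m} e = cong₂ _*_ (e zero) (prodFin-cong (e ∘ suc))

prodFin-* : (f g : Fin m → ℕ) → prodFin m (λ i → f i * g i) ≡ prodFin m f * prodFin m g
prodFin-* {zero}  f g = refl
prodFin-* {suc m} f g rewrite prodFin-* (f ∘ suc) (g ∘ suc) =
  [m*n]*[o*p]≡[m*o]*[n*p] (f zero) (g zero) (prodFin m (f ∘ suc)) (prodFin m (g ∘ suc))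

prodFin-nonZero : (f : Fin m → ℕ) → (∀ i → NonZero (f i)) → NonZero (prodFin m f)
prodFin-nonZero {zero}  f nz = _
prodFin-nonZero {suc m} f nz = m*n≢0 (f zero) _ {{nz zero}} {{prodFin-nonZero (f ∘ suc) (nz ∘ suc)}}

monomial : Vec ℕ m → Vec ℕ m → ℕ
monomial {m} a p = prodFin m (λ i → lookup a i ^ lookup p i)

monomial-+ : (a p q : Vec ℕ m) → monomial a (zipWith _+_ p q) ≡ monomial a p * monomial a q
monomial-+ a p q = trans
  (prodFin-cong λ i → trans
    (cong (lookup a i ^_) (lookup-zipWith _+_ i p q))
    (^-distribˡ-+-* (lookup a i) (lookup p i) _))
  (prodFin-* (λ i → lookup a i ^ lookup p i) _)

monomial-0 : (a : Vec ℕ m) → monomial a (replicate m 0) ≡ 1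
monomial-0 []      = refl
monomial-0 (x ∷ a) = trans (+-identityʳ _) (monomial-0 a)

monomial-basis : (a : Vec ℕ m) (r : Fin m) → monomial a (replicate m 0 [ r ]≔ 1) ≡ lookup a r
monomial-basis (x ∷ a) zero    rewrite monomial-0 a = trans (*-identityʳ _) (*-identityʳ x)
monomial-basis (x ∷ a) (suc r) = trans (*-identityˡ _) (monomial-basis a r)

^-distribʳ-* : ∀ n x y → (x * y) ^ n ≡ x ^ n * y ^ n
^-distribʳ-* zero    x y = refl
^-distribʳ-* (suc n) x y rewrite ^-distribʳ-* n x y = [m*n]*[o*p]≡[m*o]*[n*p] x y (x ^ n) (y ^ n)

pos-⊖ : ∀ m n → pos (m ⊖ n) ≡ m ∸ n
pos-⊖ zero    zero    = refl
pos-⊖ zero    (suc n) = refl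
pos-⊖ (suc m) zero    = refl
pos-⊖ (suc m) (suc n) rewrite ℤ.[1+m]⊖[1+n]≡m⊖n m n = pos-⊖ m n

neg-⊖ : ∀ m n → neg (m ⊖ n) ≡ n ∸ m
neg-⊖ zero    zero    = refl
neg-⊖ zero    (suc n) = refl
neg-⊖ (suc m) zero    = refl
neg-⊖ (suc m) (suc n) rewrite ℤ.[1+m]⊖[1+n]≡m⊖n m n = neg-⊖ m n

⊖≡0⇒≡ : ∀ m n → m ⊖ n ≡ ℤ.0ℤ → m ≡ n
⊖≡0⇒≡ m n eq = ≤-antisym (m∸n≡0⇒m≤n (trans (sym (pos-⊖ m n)) (cong pos eq)))
                         (m∸n≡0⇒m≤n (trans (sym (neg-⊖ m n)) (cong neg eq)))

-- Cancelling the common factor with exponents `p_i ⊓ q_i` leaves the positive and negative parts of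
-- `p_i - q_i` as exponents, which is the form `MultIndependent` speaks of.
monomial-injective : (a : Vec ℕ m) → (∀ i → NonZero (lookup a i)) → MultIndependent a →
  (p q : Vec ℕ m) → monomial a p ≡ monomial a q → p ≡ q
monomial-injective {m} a nz independent p q eq = Pointwise.Pointwise-≡⇒≡ (Pointwise.ext λ i →
  ⊖≡0⇒≡ (lookup p i) (lookup q i) (independent (λ i → lookup p i ⊖ lookup q i) reduced i))
  where
  open ≡-Reasoning
  common : ℕ
  common = prodFin m (λ i → lookup a i ^ (lookup p i ⊓ lookup q i))
  split : (e d : Fin m → ℕ) → (∀ i → lookup p i ⊓ lookup q i + d i ≡ e i) →
    common * prodFin m (λ i → lookup a i ^ d i) ≡ prodFin m (λ i → lookup a i ^ e i)
  split e d h = trans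
    (sym (prodFin-* (λ i → lookup a i ^ (lookup p i ⊓ lookup q i)) _))
    (prodFin-cong λ i → trans
      (sym (^-distribˡ-+-* (lookup a i) (lookup p i ⊓ lookup q i) (d i)))
      (cong (lookup a i ^_) (h i)))
  remainder⁺ : ∀ m n → m ⊓ n + pos (m ⊖ n) ≡ m
  remainder⁺ m n = trans (cong₂ _+_ (⊓-comm m n) (pos-⊖ m n)) (m⊓n+n∸m≡n n m)
  remainder⁻ : ∀ m n → m ⊓ n + neg (m ⊖ n) ≡ n
  remainder⁻ m n = trans (cong (λ r → m ⊓ n + r) (neg-⊖ m n)) (m⊓n+n∸m≡n m n)
  common≢0 : NonZero common
  common≢0 = prodFin-nonZero _ λ i → m^n≢0 (lookup a i) (lookup p i ⊓ lookup q i) {{nz i}}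
  reduced : prodFin m (λ i → lookup a i ^ pos (lookup p i ⊖ lookup q i)) ≡
            prodFin m (λ i → lookup a i ^ neg (lookup p i ⊖ lookup q i))
  reduced = *-cancelˡ-≡ _ _ common {{common≢0}} (begin
    common * prodFin m (λ i → lookup a i ^ pos (lookup p i ⊖ lookup q i))
      ≡⟨ split (lookup p) _ (λ i → remainder⁺ (lookup p i) (lookup q i)) ⟩
    monomial a p
      ≡⟨ eq ⟩
    monomial a q
      ≡⟨ split (lookup q) _ (λ i → remainder⁻ (lookup p i) (lookup q i)) ⟨
    common * prodFin m (λ i → lookup a i ^ neg (lookup p i ⊖ lookup q i)) ∎)

-- Arithmetic modulo `k + 1`.

module _ (k : ℕ) where

  infix 4 _≈_

  _≈_ : ℕ → ℕ → Set
  x ≈ y = x % suc k ≡ y % suc k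

  *-cong-≈ : ∀ {x x′ y y′} → x ≈ x′ → y ≈ y′ → x * y ≈ x′ * y′
  *-cong-≈ {x} {x′} {y} {y′} e f = begin
    (x * y) % suc k                         ≡⟨ %-distribˡ-* x y (suc k) ⟩
    ((x % suc k) * (y % suc k)) % suc k     ≡⟨ cong₂ (λ a b → (a * b) % suc k) e f ⟩
    ((x′ % suc k) * (y′ % suc k)) % suc k   ≡⟨ %-distribˡ-* x′ y′ (suc k) ⟨
    (x′ * y′) % suc k                       ∎
    where open ≡-Reasoning

  *-congˡ-≈ : ∀ x {y y′} → y ≈ y′ → x * y ≈ x * y′
  *-congˡ-≈ x = *-cong-≈ {x} {x} refl

  unit-cancelˡ : ∀ u v {x y} → u * v ≈ 1 → u * x ≈ u * y → x ≈ y
  unit-cancelˡ u v {x} {y} uv≈1 e = begin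
    x % suc k              ≡⟨ cong (_% suc k) (*-identityˡ x) ⟨
    (1 * x) % suc k        ≡⟨ *-cong-≈ {u * v} {1} {x} {x} uv≈1 refl ⟨
    (u * v * x) % suc k    ≡⟨ cong (_% suc k) (rearrange u v x) ⟩
    (v * (u * x)) % suc k  ≡⟨ *-congˡ-≈ v {u * x} {u * y} e ⟩
    (v * (u * y)) % suc k  ≡⟨ cong (_% suc k) (rearrange u v y) ⟨
    (u * v * y) % suc k    ≡⟨ *-cong-≈ {u * v} {1} {y} {y} uv≈1 refl ⟩
    (1 * y) % suc k        ≡⟨ cong (_% suc k) (*-identityˡ y) ⟩
    y % suc k              ∎
    where
    open ≡-Reasoning
    rearrange : ∀ u v x → u * v * x ≡ v * (u * x)
    rearrange = solve-∀

  prodFin-≈1 : (f : Fin m → ℕ) → (∀ i → f i ≈ 1) → prodFin m f ≈ 1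
  prodFin-≈1 {zero}  f e = refl
  prodFin-≈1 {suc m} f e = *-cong-≈ {f zero} {1} {_} {1} (e zero) (prodFin-≈1 (f ∘ suc) (e ∘ suc))

  ^-≈1 : ∀ {x} n → x ≈ 1 → x ^ n ≈ 1
  ^-≈1         zero    e = refl
  ^-≈1 {x}     (suc n) e = *-cong-≈ {x} {1} {_} {1} e (^-≈1 {x} n e)

  -- A positive number below a prime is coprime to it. Over the naturals Bézout's identity comes in
  -- two sign patterns, each with its own witness.
  inverse : Prime (suc k) → ∀ x .{{_ : NonZero x}} → x < suc k → ∃ λ y → x * y ≈ 1
  inverse p-prime x x<p with coprime-Bézout (prime⇒coprime p-prime x<p)
  ... | Bézout.-+ u v eq = v , (begin
    (x * v) % suc k          ≡⟨ cong (_% suc k) (trans (*-comm x v) (sym eq)) ⟩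
    (1 + u * suc k) % suc k  ≡⟨ [m+kn]%n≡m%n 1 u (suc k) ⟩
    1 % suc k                ∎)
    where open ≡-Reasoning
  -- Here 1 + v x = u (k + 1), so that v is the inverse of −x; and k ≡ −1.
  ... | Bézout.+- u v eq = v * k , (begin
    (x * (v * k)) % suc k              ≡⟨ [m+n]%n≡m%n (x * (v * k)) (suc k) ⟨
    (x * (v * k) + suc k) % suc k      ≡⟨ cong (_% suc k) (trans (rearrange x v k) (cong (λ z → 1 + z * k) eq)) ⟩
    (1 + u * suc k * k) % suc k        ≡⟨ cong (λ z → (1 + z) % suc k) (swap-factors u (suc k) k) ⟩
    (1 + u * k * suc k) % suc k        ≡⟨ [m+kn]%n≡m%n 1 (u * k) (suc k) ⟩
    1 % suc k                          ∎)
    where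
    open ≡-Reasoning
    rearrange : ∀ x v k → x * (v * k) + (1 + k) ≡ 1 + (1 + v * x) * k
    rearrange = solve-∀
    swap-factors : ∀ u p k → u * p * k ≡ u * k * p
    swap-factors = solve-∀

-- The multiplication action on `Gak a k`.

-- The vertices of `Gak a k` are the nonzero residues modulo `k + 1`, stored with an offset of one.
label : Fin n → ℕ
label v = suc (toℕ v)

label-injective : {u v : Fin n} → label u ≡ label v → u ≡ v
label-injective = Fin.toℕ-injective ∘ suc-injective

label-% : ∀ {k} (v : Fin k) → label v % suc k ≡ label v
label-% v = m<n⇒m%n≡m (s≤s (Fin.toℕ<n v))

vertex : ∀ {k} y → y ≢ 0 → y < suc k → Fin k
vertex zero    y≢0 _         = contradiction refl y≢0
vertex (suc y) _   (s≤s y<k) = fromℕ< y<k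

label-vertex : ∀ {k} y (y≢0 : y ≢ 0) (y<p : y < suc k) → label (vertex y y≢0 y<p) ≡ y
label-vertex zero    y≢0 _         = contradiction refl y≢0
label-vertex (suc y) _   (s≤s y<k) = cong suc (Fin.toℕ-fromℕ< y<k)

module _ {k : ℕ} (p-prime : Prime (suc k)) (a : Vec ℕ m) (nz : ∀ i → NonZero (lookup a i))
         (a<p : ∀ i → lookup a i < suc k) where

  private
    infix 4 _~_
    _~_ = _≈_ k

  a⁻¹ : Vec ℕ m
  a⁻¹ = Vec.tabulate λ i → proj₁ (inverse k p-prime (lookup a i) {{nz i}} (a<p i))

  a*a⁻¹ : ∀ i → lookup a i * lookup a⁻¹ i ~ 1
  a*a⁻¹ i rewrite lookup∘tabulate (λ i → proj₁ (inverse k p-prime (lookup a i) {{nz i}} (a<p i))) i =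
    proj₂ (inverse k p-prime (lookup a i) {{nz i}} (a<p i))

  monomial-inverse : ∀ p → monomial a p * monomial a⁻¹ p ~ 1
  monomial-inverse p = begin
    (monomial a p * monomial a⁻¹ p) % suc k
      ≡⟨ cong (_% suc k) (prodFin-* (λ i → lookup a i ^ lookup p i) _) ⟨
    prodFin m (λ i → lookup a i ^ lookup p i * lookup a⁻¹ i ^ lookup p i) % suc k
      ≡⟨ prodFin-≈1 k _ (λ i → trans
           (cong (_% suc k) (sym (^-distribʳ-* (lookup p i) (lookup a i) (lookup a⁻¹ i))))
           (^-≈1 k {lookup a i * lookup a⁻¹ i} (lookup p i) (a*a⁻¹ i))) ⟩
    1 % suc k ∎
    where open ≡-Reasoning

  -- Powers of the modular inverses `a⁻¹` replace negative exponents, so the multiplier stays a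
  -- natural number; `p` and `q` cancel only modulo `k + 1`.
  multiplier : Shift m → ℕ
  multiplier (p , q) = monomial a p * monomial a⁻¹ q

  multiplier-⊹ : ∀ g h → multiplier (g ⊹ h) ≡ multiplier g * multiplier h
  multiplier-⊹ (p , q) (p′ , q′) = trans
    (cong₂ _*_ (monomial-+ a p p′) (monomial-+ a⁻¹ q q′))
    ([m*n]*[o*p]≡[m*o]*[n*p] (monomial a p) (monomial a p′) (monomial a⁻¹ q) (monomial a⁻¹ q′))

  multiplier-unit : ∀ g → multiplier g * multiplier (swap g) ~ 1
  multiplier-unit (p , q) = begin
    (multiplier (p , q) * multiplier (q , p)) % suc k
      ≡⟨ cong (_% suc k) (rearrange (monomial a p) (monomial a⁻¹ q) (monomial a q) (monomial a⁻¹ p)) ⟩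
    ((monomial a p * monomial a⁻¹ p) * (monomial a q * monomial a⁻¹ q)) % suc k
      ≡⟨ *-cong-≈ k {monomial a p * monomial a⁻¹ p} {1} {_} {1} (monomial-inverse p) (monomial-inverse q) ⟩
    1 % suc k ∎
    where
    open ≡-Reasoning
    rearrange : ∀ a b c d → a * b * (c * d) ≡ a * d * (c * b)
    rearrange = solve-∀

  multiplier-basis : ∀ r → multiplier (basis r) ≡ lookup a r
  multiplier-basis r = trans (cong₂ _*_ (monomial-basis a r) (monomial-0 a⁻¹)) (*-identityʳ _)

  -- The multiplier is a unit, so a zero product would make `label v` a zero residue, yet labels run
  -- from 1 to `k`.
  multiply-≢0 : ∀ g (v : Fin k) → (multiplier g * label v) % suc k ≢ 0
  multiply-≢0 g v eq = contradiction (trans (sym (label-% v)) label~0) λ ()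
    where
    label~0 : label v ~ 0
    label~0 = unit-cancelˡ k (multiplier g) (multiplier (swap g)) {label v} {0} (multiplier-unit g)
      (trans eq (cong (_% suc k) (sym (*-zeroʳ (multiplier g)))))

  multiply : Shift m → Fin k → Fin k
  multiply g v =
    vertex ((multiplier g * label v) % suc k) (multiply-≢0 g v) (m%n<n (multiplier g * label v) (suc k))

  label-multiply : ∀ g v → label (multiply g v) ≡ (multiplier g * label v) % suc k
  label-multiply g v =
    label-vertex ((multiplier g * label v) % suc k) (multiply-≢0 g v) (m%n<n (multiplier g * label v) (suc k))

  multiplication : Action m k
  multiplication = record
    { act      = multiply
    ; act-⊹    = λ g h v → label-injective (begin
        label (multiply (g ⊹ h) v)
          ≡⟨ label-multiply (g ⊹ h) v ⟩
        (multiplier (g ⊹ h) * label v) % suc k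
          ≡⟨ cong (_% suc k) (trans (cong (_* label v) (multiplier-⊹ g h)) (*-assoc (multiplier g) _ _)) ⟩
        (multiplier g * (multiplier h * label v)) % suc k
          ≡⟨ *-congˡ-≈ k (multiplier g) {label (multiply h v)} (trans
               (cong (_% suc k) (label-multiply h v))
               (m%n%n≡m%n (multiplier h * label v) (suc k))) ⟨
        (multiplier g * label (multiply h v)) % suc k
          ≡⟨ label-multiply g (multiply h v) ⟨
        label (multiply g (multiply h v)) ∎)
    ; act-null = λ p v → label-injective (begin
        label (multiply (p , p) v)              ≡⟨ label-multiply (p , p) v ⟩
        (multiplier (p , p) * label v) % suc k
          ≡⟨ *-cong-≈ k {multiplier (p , p)} {1} {label v} {label v} (monomial-inverse p) refl ⟩
        (1 * label v) % suc k                   ≡⟨ cong (_% suc k) (*-identityˡ (label v)) ⟩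
        label v % suc k                         ≡⟨ label-% v ⟩
        label v                                 ∎)
    }
    where open ≡-Reasoning

  -- At a fixed point the unit `label v` cancels, so the multiplier is congruent to 1 and the two
  -- monomials are congruent. Both lie below the modulus, hence they are equal integers, and
  -- independence gives `p ≡ q`.
  multiplication-free : MultIndependent a → ∀ p q → monomial a p < suc k → monomial a q < suc k →
    Action.Free multiplication (p , q)
  multiplication-free independent p q p< q< nonnull v fixed = nonnull
    (monomial-injective a nz independent p q (begin
    monomial a p            ≡⟨ m<n⇒m%n≡m p< ⟨
    monomial a p % suc k    ≡⟨ unit-cancelˡ k (monomial a⁻¹ q) (monomial a q) {monomial a p} {monomial a q}
                                 q⁻¹q~1 q⁻¹p~q⁻¹q ⟩
    monomial a q % suc k    ≡⟨ m<n⇒m%n≡m q< ⟩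
    monomial a q            ∎))
    where
    open ≡-Reasoning
    label⁻¹ = inverse k p-prime (label v) (s≤s (Fin.toℕ<n v))
    multiplier~1 : multiplier (p , q) ~ 1
    multiplier~1 = unit-cancelˡ k (label v) (proj₁ label⁻¹) {multiplier (p , q)} {1} (proj₂ label⁻¹) (begin
      (label v * multiplier (p , q)) % suc k  ≡⟨ cong (_% suc k) (*-comm (label v) (multiplier (p , q))) ⟩
      (multiplier (p , q) * label v) % suc k  ≡⟨ label-multiply (p , q) v ⟨
      label (multiply (p , q) v)              ≡⟨ cong label fixed ⟩
      label v                                 ≡⟨ label-% v ⟨
      label v % suc k                         ≡⟨ cong (_% suc k) (*-identityʳ (label v)) ⟨
      (label v * 1) % suc k                   ∎)
    q⁻¹q~1 : monomial a⁻¹ q * monomial a q ~ 1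
    q⁻¹q~1 = trans (cong (_% suc k) (*-comm (monomial a⁻¹ q) _)) (monomial-inverse q)
    q⁻¹p~q⁻¹q : monomial a⁻¹ q * monomial a p ~ monomial a⁻¹ q * monomial a q
    q⁻¹p~q⁻¹q = begin
      (monomial a⁻¹ q * monomial a p) % suc k  ≡⟨ cong (_% suc k) (*-comm (monomial a⁻¹ q) _) ⟩
      multiplier (p , q) % suc k               ≡⟨ multiplier~1 ⟩
      1 % suc k                                ≡⟨ q⁻¹q~1 ⟨
      (monomial a⁻¹ q * monomial a q) % suc k  ∎

  -- Labels are already reduced, so congruent labels belong to the same vertex.
  congruent⇔ : ∀ r u v → (label u % suc k ≡ (lookup a r * label v) % suc k) ⇔ (u ≡ multiply (basis r) v)
  congruent⇔ r u v = mk⇔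
    (λ e → label-injective (trans (sym (label-% u)) (trans e (sym label-step))))
    (λ { refl → trans (label-% (multiply (basis r) v)) label-step })
    where
    label-step : label (multiply (basis r) v) ≡ (lookup a r * label v) % suc k
    label-step = trans (label-multiply (basis r) v) (cong (λ c → (c * label v) % suc k) (multiplier-basis r))

  Gak-gridLike : MultIndependent a → {gs : List (Shift m)} →
    All (λ (p , q) → monomial a p < suc k × monomial a q < suc k) gs → GridLike gs (Gak a k)
  Gak-gridLike independent small = record
    { action = multiplication
    ; free   = All.map (λ {(p , q)} (p< , q<) → multiplication-free independent p q p< q<) small
    ; adj⇔   = λ u v → mk⇔
        (λ (u≢v , r , e) → u≢v , r , Sum.map (to (congruent⇔ r u v)) (to (congruent⇔ r v u)) e)
        (λ (u≢v , r , e) → u≢v , r , Sum.map (from (congruent⇔ r u v)) (from (congruent⇔ r v u)) e)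
    }

-- How large the primes must be.

∑-bound : {A : Set} (f : A → ℕ) {xs : List A} {x : A} → x LM.∈ xs → f x ≤ ∑ xs f
∑-bound f (here refl)          = m≤m+n _ _
∑-bound f {y ∷ xs} (there x∈)  = ≤-trans (∑-bound f x∈) (m≤n+m _ (f y))

module _ (a : Vec ℕ m) (gs : List (Shift m)) where

  size : Shift m → ℕ
  size (p , q) = monomial a p + monomial a q

  -- The first sum dominates every monomial of a shift in `gs`, as freeness requires; the second
  -- dominates every `a_i`, making it invertible modulo the prime. The successor makes both
  -- comparisons strict.
  bound : ℕ
  bound = suc (∑ gs size + ∑ (allFin m) (lookup a))

  GSum-gridLike : (∀ i → 2 ≤ lookup a i) → MultIndependent a → (ks : List ℕ) →
    All (λ k → Prime (suc k) × bound ≤ suc k) ks → GridLike gs (GSum a ks)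
  GSum-gridLike a≥2 independent []       []                       = emptyGraph-gridLike gs
  GSum-gridLike a≥2 independent (k ∷ ks) ((p-prime , large) ∷ rest) = ⊕-gridLike
    (Gak-gridLike p-prime a (λ i → >-nonZero (≤-trans (s≤s z≤n) (a≥2 i))) a<p independent (All.tabulate small))
    (GSum-gridLike a≥2 independent ks rest)
    where
    a<p : ∀ i → lookup a i < suc k
    a<p i = ≤-trans (s≤s (≤-trans (∑-bound (lookup a) (∈-allFin i)) (m≤n+m _ (∑ gs size)))) large
    small : ∀ {g} → g LM.∈ gs → monomial a (proj₁ g) < suc k × monomial a (proj₂ g) < suc k
    small {p , q} g∈ =
      <-≤-trans (s≤s (≤-trans (m≤m+n _ _) size≤)) large ,
      <-≤-trans (s≤s (≤-trans (m≤n+m _ _) size≤)) large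
      where
      size≤ : size (p , q) ≤ ∑ gs size + ∑ (allFin m) (lookup a)
      size≤ = ≤-trans (∑-bound size g∈) (m≤m+n _ _)

theorem3p1 : Σ (ℕ → ℕ → ℕ → ℕ) λ f →
    (m : ℕ) (a : Vec ℕ m) →
    (∀ i j → lookup a i ≡ lookup a j → i ≡ j) →
    (∀ i → 2 ≤ lookup a i) →
    MultIndependent a →
    (n : ℕ) → Σ ℕ λ B →
    (ks : List ℕ) →
    All (λ k → Prime (suc k) × B ≤ suc k) ks →
    NumIndepSets≡ (GSum a ks) n (f n m (sum ks))
-- The list `needed (system m n)` depends on `m` and `n` only, so one bound serves all lists `ks`.
theorem3p1 = indepCount , λ m a _ a≥2 independent n →
  bound a (needed (system m n)) , λ ks large →
    gridLike-numIndepSets n (GSum-gridLike a (needed (system m n)) a≥2 independent ks large)
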